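{- In PI, if $P\sim_g Q$ then $P\sigma\sim_g Q\sigma$ for every substitution $\sigma$.
   Context: PI is the finite, sum-free $\pi$-calculus over an infinite set of names: prefixes $\pi::=m(x)\mid\overline m\langle n\rangle$ and processes $P::=\mathbf 0\mid\pi.P\mid P_1|P_2\mid(\nu p)P$; $m(x)$ binds $x$ and $(\nu p)$ binds $p$; $\mathrm{fn}(P)$ denotes free names; processes are taken up to $\alpha$-conversion and satisfy the convention that bound names are pairwise distinct and distinct from free names. Substitutions $\sigma$ map names to names and are applied capture-avoidingly; $P[n/x]$ replaces $x$ by $n$. Late transitions $P\xrightarrow{\mu}P'$ with labels $\mu::=a(x)\mid\overline a\langle b\rangle\mid\overline a(p)\mid\tau$ (bound names: $x$ in $a(x)$, $p$ in $\overline a(p)$) are given by: $\pi.P\xrightarrow{\pi}P$; if $P\xrightarrow{a(x)}P'$ and $Q\xrightarrow{\overline a\langle b\rangle}Q'$ then $P|Q\xrightarrow{\tau}P'[b/x]|Q'$; if $P\xrightarrow{\overline a\langle b\rangle}P'$ and $a\neq b$ then $(\nu b)P\xrightarrow{\overline a(b)}P'$; if $P\xrightarrow{a(x)}P'$ and $Q\xrightarrow{\overline a(p)}Q'$ then $P|Q\xrightarrow{\tau}(\nu p)(P'[p/x]|Q')$; if $P\xrightarrow{\mu}P'$ and the bound names of $\mu$ are not free in $Q$ then $P|Q\xrightarrow{\mu}P'|Q$; if $P\xrightarrow{\mu}P'$ and $p$ is not a free name of $\mu$ then $(\nu p)P\xrightarrow{\mu}(\nu p)P'$; plus the symmetric versions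 of the rules involving $|$. A ground bisimulation is a symmetric relation $\mathcal R$ such that $P\mathcal RQ$ and $P\xrightarrow{\mu}P'$ imply $Q\xrightarrow{\mu}Q'$ with $P'\mathcal RQ'$ for some $Q'$; ground bisimilarity $\sim_g$ is the union of all ground bisimulations. -}

module Defs where

-- The finite, sum-free π-calculus PI, with names represented by
-- de Bruijn indices (ℕ).  Processes up to α-conversion are thus
-- represented canonically; binders (input m(x), restriction (ν p), and
-- the bound names of labels a(x), ā(p)) are anonymous, index 0 referring
-- to the innermost binder.  A free name n of a closed-scope process is
-- the index n (counted past the enclosing binders).

open import Data.Nat using (ℕ; zero; suc)
open import Data.Bool using (Bool; true; false)
open import Data.Product using (Σ; _×_; _,_)

Name : Set
Name = ℕ

data Proc : Set where
  𝟘   : Proc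
  inp : Name → Proc → Proc          -- m(x).P ; x is index 0 in P
  out : Name → Name → Proc → Proc
  _∣_ : Proc → Proc → Proc
  ν   : Proc → Proc                 -- (ν p) P ; p is index 0 in P

infixr 5 _∣_

ext : (Name → Name) → Name → Name
ext σ zero    = zero
ext σ (suc n) = suc (σ n)

_[_] : Proc → (Name → Name) → Proc
𝟘         [ σ ] = 𝟘
inp m P   [ σ ] = inp (σ m) (P [ ext σ ])
out m n P [ σ ] = out (σ m) (σ n) (P [ σ ])
(P ∣ Q)   [ σ ] = (P [ σ ]) ∣ (Q [ σ ])
ν P       [ σ ] = ν (P [ ext σ ])

inst : Name → Name → Name
inst b zero    = b
inst b (suc n) = n

_[_/0] : Proc → Name → Proc
P [ b /0] = P [ inst b ]

-- weakening (the bound name of a label is not free in the other side)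
wk : Proc → Proc
wk P = P [ suc ]

swap : Name → Name
swap zero          = suc zero
swap (suc zero)    = zero
swap (suc (suc n)) = suc (suc n)

data Label : Set where
  inL   : Name → Label
  outL  : Name → Name → Label
  boutL : Name → Label
  τ     : Label

binding : Label → Bool
binding (inL _)    = true
binding (outL _ _) = false
binding (boutL _)  = true
binding τ          = false

-- free names of a label shifted past one binder (so that the label
-- does not mention the restricted name 0)
shiftL : Label → Label
shiftL (inL a)    = inL (suc a)
shiftL (outL a b) = outL (suc a) (suc b)
shiftL (boutL a)  = boutL (suc a)
shiftL τ          = τ

-- weaken Q iff μ binds a name (the derivative of a binding transition
-- lives under one extra binder, index 0 = the bound name of μ)
wkIf : Bool → Proc → Proc
wkIf true  Q = wk Q
wkIf false Q = Q

-- restriction of a derivative: for binding labels the bound name of the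
-- label must remain the outermost binder, so the two binders are swapped
resIf : Bool → Proc → Proc
resIf true  P = ν (P [ swap ])
resIf false P = ν P

-- Late transitions  P —[ μ ]→ P'.  If μ is binding (a(x) or ā(p)) then
-- P' is under one extra binder whose index 0 is the bound name of μ.
data _—[_]→_ : Proc → Label → Proc → Set where
  pre-in  : ∀ {a P} → inp a P —[ inL a ]→ P
  pre-out : ∀ {a b P} → out a b P —[ outL a b ]→ P
  comm-l  : ∀ {P P' Q Q' a b} → P —[ inL a ]→ P' → Q —[ outL a b ]→ Q' →
            (P ∣ Q) —[ τ ]→ ((P' [ b /0]) ∣ Q')
  comm-r  : ∀ {P P' Q Q' a b} → P —[ outL a b ]→ P' → Q —[ inL a ]→ Q' →
            (P ∣ Q) —[ τ ]→ (P' ∣ (Q' [ b /0]))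
  open'   : ∀ {P P' a} → P —[ outL (suc a) zero ]→ P' →
            ν P —[ boutL a ]→ P'
  close-l : ∀ {P P' Q Q' a} → P —[ inL a ]→ P' → Q —[ boutL a ]→ Q' →
            (P ∣ Q) —[ τ ]→ ν (P' ∣ Q')
  close-r : ∀ {P P' Q Q' a} → P —[ boutL a ]→ P' → Q —[ inL a ]→ Q' →
            (P ∣ Q) —[ τ ]→ ν (P' ∣ Q')
  par-l   : ∀ {P P' Q μ} → P —[ μ ]→ P' →
            (P ∣ Q) —[ μ ]→ (P' ∣ wkIf (binding μ) Q)
  par-r   : ∀ {P Q Q' μ} → Q —[ μ ]→ Q' →
            (P ∣ Q) —[ μ ]→ (wkIf (binding μ) P ∣ Q')
  res     : ∀ {P P' μ} → P —[ shiftL μ ]→ P' →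
            ν P —[ μ ]→ resIf (binding μ) P'

Rel : Set₁
Rel = Proc → Proc → Set

Symmetric : Rel → Set
Symmetric R = ∀ {P Q} → R P Q → R Q P

IsGroundBisim : Rel → Set
IsGroundBisim R = Symmetric R ×
  (∀ {P Q μ P'} → R P Q → P —[ μ ]→ P' →
     Σ Proc (λ Q' → (Q —[ μ ]→ Q') × R P' Q'))

_∼g_ : Proc → Proc → Set₁
P ∼g Q = Σ Rel (λ R → IsGroundBisim R × R P Q)

{-# OPTIONS --safe #-}

-- The only transitions of P σ that do not come from transitions of P are
-- communications between an input a(x) and an output on b in parallel
-- components of P, where σ identifies a and b.  If P ∼g Q, then Q matches the
-- input and the output in both orders, and one of these two runs of Q must fire
-- parallel prefixes.  Otherwise, ignoring restricted and received names, Q has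
-- parallel components a.A and b.B, where A can do the output and B the input,
-- and A' | b.B and a.A | B', next to the same context, are bisimilar.  This
-- contradicts the invariance under bisimilarity of the total size of the
-- input-rooted components.
module Submission where

open import Defs
open import Data.Nat using (ℕ; zero; suc; _+_; _≤_; _<_; z≤n; s≤s)
open import Data.Nat.Properties
open import Algebra.Properties.CommutativeSemigroup +-commutativeSemigroup using (interchange)
open import Data.Bool using (Bool; true; false; if_then_else_)
open import Data.Product using (Σ; ∃; ∃₂; _×_; _,_)
open import Data.Sum using (_⊎_; inj₁; inj₂)
open import Data.Empty using (⊥-elim)
open import Function using (_∘_)
open import Relation.Binary.PropositionalEquality
  using (_≡_; refl; sym; trans; cong; cong₂; subst; subst₂; _≗_)

private variable
  P Q P' Q' X X' Y Z : Proc
  a b c : Name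
  μ : Label
  σ ρ σ' ρ' θ : Name → Name

-- Substitutions

ext-cong : σ ≗ ρ → ext σ ≗ ext ρ
ext-cong e zero    = refl
ext-cong e (suc n) = cong suc (e n)

sub-cong : ∀ P → σ ≗ ρ → P [ σ ] ≡ P [ ρ ]
sub-cong 𝟘           e = refl
sub-cong (inp m P)   e = cong₂ inp (e m) (sub-cong P (ext-cong e))
sub-cong (out m n P) e rewrite e m | e n = cong (out _ _) (sub-cong P e)
sub-cong (P ∣ Q)     e = cong₂ _∣_ (sub-cong P e) (sub-cong Q e)
sub-cong (ν P)       e = cong ν (sub-cong P (ext-cong e))

ext-∘ : ext ρ ∘ ext σ ≗ ext (ρ ∘ σ)
ext-∘ zero    = refl
ext-∘ (suc n) = refl

sub-∘ : ∀ P → P [ σ ] [ ρ ] ≡ P [ ρ ∘ σ ]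
sub-∘ 𝟘           = refl
sub-∘ (inp m P)   = cong (inp _) (trans (sub-∘ P) (sub-cong P ext-∘))
sub-∘ (out m n P) = cong (out _ _) (sub-∘ P)
sub-∘ (P ∣ Q)     = cong₂ _∣_ (sub-∘ P) (sub-∘ Q)
sub-∘ (ν P)       = cong ν (trans (sub-∘ P) (sub-cong P ext-∘))

ext-id : σ ≗ (λ n → n) → ext σ ≗ (λ n → n)
ext-id e zero    = refl
ext-id e (suc n) = cong suc (e n)

sub-id : ∀ P → σ ≗ (λ n → n) → P [ σ ] ≡ P
sub-id 𝟘           e = refl
sub-id (inp m P)   e = cong₂ inp (e m) (sub-id P (ext-id e))
sub-id (out m n P) e rewrite e m | e n = cong (out _ _) (sub-id P e)
sub-id (P ∣ Q)     e = cong₂ _∣_ (sub-id P e) (sub-id Q e)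
sub-id (ν P)       e = cong ν (sub-id P (ext-id e))

sub-comm : ∀ P → ρ ∘ σ ≗ ρ' ∘ σ' → P [ σ ] [ ρ ] ≡ P [ σ' ] [ ρ' ]
sub-comm P e = trans (sub-∘ P) (trans (sub-cong P e) (sym (sub-∘ P)))

sub-fuse : ∀ P → ρ ∘ σ ≗ θ → P [ σ ] [ ρ ] ≡ P [ θ ]
sub-fuse P e = trans (sub-∘ P) (sub-cong P e)

sub-cancel : ∀ P → ρ ∘ σ ≗ (λ n → n) → P [ σ ] [ ρ ] ≡ P
sub-cancel P e = trans (sub-∘ P) (sub-id P e)

wk-sub : ∀ P → wk P [ ext σ ] ≡ wk (P [ σ ])
wk-sub P = sub-comm P (λ _ → refl)

inst-sub : ∀ P → P [ b /0] [ σ ] ≡ P [ ext σ ] [ σ b /0]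
inst-sub P = sub-comm P λ { zero → refl ; (suc n) → refl }

swap-sub : ∀ P → P [ swap ] [ ext (ext σ) ] ≡ P [ ext (ext σ) ] [ swap ]
swap-sub P = sub-comm P λ { zero → refl ; (suc zero) → refl ; (suc (suc n)) → refl }

wk-inst : ∀ P → wk P [ b /0] ≡ P
wk-inst P = sub-cancel P (λ _ → refl)

ext-suc-inst : ∀ P → P [ ext suc ] [ zero /0] ≡ P
ext-suc-inst P = sub-cancel P λ { zero → refl ; (suc n) → refl }

swap-swap : ∀ P → P [ swap ] [ swap ] ≡ P
swap-swap P = sub-cancel P λ { zero → refl ; (suc zero) → refl ; (suc (suc n)) → refl }

wk-wk-swap : ∀ P → wk (wk P) [ swap ] ≡ wk (wk P)
wk-wk-swap P = trans (cong (_[ swap ]) (sub-∘ P)) (trans (sub-∘ P) (sym (sub-∘ P)))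

wk-swap : ∀ P → wk P [ swap ] ≡ P [ ext suc ]
wk-swap P = sub-fuse P λ { zero → refl ; (suc n) → refl }

ext-suc-swap : ∀ P → P [ ext suc ] [ swap ] ≡ wk P
ext-suc-swap P = sub-fuse P λ { zero → refl ; (suc n) → refl }

swap-inst : ∀ P → P [ swap ] [ zero /0] ≡ P [ zero /0]
swap-inst P = sub-fuse P λ { zero → refl ; (suc zero) → refl ; (suc (suc n)) → refl }

swap-ext-inst : ∀ P → P [ swap ] [ ext (inst c) ] ≡ P [ suc c /0]
swap-ext-inst P = sub-fuse P λ { zero → refl ; (suc zero) → refl ; (suc (suc n)) → refl }

braid : ∀ P → P [ swap ] [ ext swap ] [ swap ] ≡ P [ ext swap ] [ swap ] [ ext swap ]
braid P = trans (cong (_[ swap ]) (sub-∘ P)) (trans (sub-∘ P) (sym (trans (cong (_[ ext swap ]) (sub-∘ P))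
  (trans (sub-∘ P) (sub-cong P λ { zero → refl ; (suc zero) → refl ; (suc (suc zero)) → refl ; (suc (suc (suc n))) → refl })))))

ext-swap-swap : ∀ P → P [ ext swap ] [ ext swap ] ≡ P
ext-swap-swap P = sub-cancel P
  λ { zero → refl ; (suc zero) → refl ; (suc (suc zero)) → refl ; (suc (suc (suc n))) → refl }

inst-swap : ∀ P → P [ zero /0] [ swap ] ≡ P [ ext swap ] [ swap ] [ ext (inst zero) ]
inst-swap P = sym (trans (cong (_[ ext (inst zero) ]) (sub-∘ P)) (sub-comm P
  λ { zero → refl ; (suc zero) → refl ; (suc (suc zero)) → refl ; (suc (suc (suc n))) → refl }))

ext-swap-inst-swap : ∀ P → P [ ext swap ] [ zero /0] [ swap ] ≡ P [ swap ] [ ext (inst zero) ]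
ext-swap-inst-swap P = trans (inst-swap (P [ ext swap ]))
  (cong (λ Q → Q [ swap ] [ ext (inst zero) ]) (ext-swap-swap P))

-- Transitions under substitution

-- The derivative of a binding transition lives under the bound name of its label, which a
-- substitution must fix.
extIf : Bool → (Name → Name) → Name → Name
extIf true  σ = ext σ
extIf false σ = σ

mapL : (Name → Name) → Label → Label
mapL σ (inL a)    = inL (σ a)
mapL σ (outL a b) = outL (σ a) (σ b)
mapL σ (boutL a)  = boutL (σ a)
mapL σ τ          = τ

infixl 4 _▸_

_▸_ : P —[ μ ]→ X → X ≡ Y → P —[ μ ]→ Y
t ▸ refl = t

sub-step : P —[ μ ]→ P' → (P [ σ ]) —[ mapL σ μ ]→ (P' [ extIf (binding μ) σ ])
sub-step pre-in  = pre-in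
sub-step pre-out = pre-out
sub-step (comm-l {P' = P'} t u) = comm-l (sub-step t) (sub-step u) ▸ cong (_∣ _) (sym (inst-sub P'))
sub-step (comm-r {Q' = Q'} t u) = comm-r (sub-step t) (sub-step u) ▸ cong (_ ∣_) (sym (inst-sub Q'))
sub-step (open' t)     = open' (sub-step t)
sub-step (close-l t u) = close-l (sub-step t) (sub-step u)
sub-step (close-r t u) = close-r (sub-step t) (sub-step u)
sub-step (par-l {Q = Q} {μ = inL _} t)   = par-l (sub-step t) ▸ cong (_ ∣_) (sym (wk-sub Q))
sub-step (par-l {μ = outL _ _} t)        = par-l (sub-step t)
sub-step (par-l {Q = Q} {μ = boutL _} t) = par-l (sub-step t) ▸ cong (_ ∣_) (sym (wk-sub Q))
sub-step (par-l {μ = τ} t)               = par-l (sub-step t)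
sub-step (par-r {P = P} {μ = inL _} t)   = par-r (sub-step t) ▸ cong (_∣ _) (sym (wk-sub P))
sub-step (par-r {μ = outL _ _} t)        = par-r (sub-step t)
sub-step (par-r {P = P} {μ = boutL _} t) = par-r (sub-step t) ▸ cong (_∣ _) (sym (wk-sub P))
sub-step (par-r {μ = τ} t)               = par-r (sub-step t)
sub-step (res {P' = P'} {μ = inL _} t)   = res (sub-step t) ▸ cong ν (sym (swap-sub P'))
sub-step (res {μ = outL _ _} t)          = res (sub-step t)
sub-step (res {P' = P'} {μ = boutL _} t) = res (sub-step t) ▸ cong ν (sym (swap-sub P'))
sub-step (res {μ = τ} t)                 = res (sub-step t)

unswap-step : (P [ swap ]) —[ μ ]→ X → P —[ mapL swap μ ]→ (X [ extIf (binding μ) swap ])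
unswap-step {P = P} t = subst (_—[ _ ]→ _) (swap-swap P) (sub-step t)

-- A substitution renames subjects but creates no prefixes, so every visible action of an instance
-- comes from an action of the process itself.
unsub-in : ∀ P → (P [ σ ]) —[ inL a ]→ X →
  ∃₂ λ a' P' → P —[ inL a' ]→ P' × a ≡ σ a' × X ≡ P' [ ext σ ]
unsub-in (inp m P) pre-in = m , P , pre-in , refl , refl
unsub-in (P ∣ Q) (par-l t) with unsub-in P t
... | _ , _ , u , refl , refl = _ , _ , par-l u , refl , cong (_ ∣_) (sym (wk-sub Q))
unsub-in (P ∣ Q) (par-r t) with unsub-in Q t
... | _ , _ , u , refl , refl = _ , _ , par-r u , refl , cong (_∣ _) (sym (wk-sub P))
unsub-in (ν P) (res t) with unsub-in P t
-- The subject in `P` cannot be `zero`: `ext σ` fixes the restricted name, while `res` requires a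
-- successor.
... | suc _ , P' , u , refl , refl = _ , _ , res u , refl , cong ν (sym (swap-sub P'))

unsub-out : ∀ P → (P [ σ ]) —[ outL a b ]→ X →
  Σ Name λ a' → ∃₂ λ b' P' → P —[ outL a' b' ]→ P' × a ≡ σ a' × b ≡ σ b' × X ≡ P' [ σ ]
unsub-out (out m n P) pre-out = m , n , P , pre-out , refl , refl , refl
unsub-out (P ∣ Q) (par-l t) with unsub-out P t
... | _ , _ , _ , u , refl , refl , refl = _ , _ , _ , par-l u , refl , refl , refl
unsub-out (P ∣ Q) (par-r t) with unsub-out Q t
... | _ , _ , _ , u , refl , refl , refl = _ , _ , _ , par-r u , refl , refl , refl
unsub-out (ν P) (res t) with unsub-out P t
... | suc _ , suc _ , _ , u , refl , refl , refl = _ , _ , _ , res u , refl , refl , refl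

unsub-bout : ∀ P → (P [ σ ]) —[ boutL a ]→ X →
  ∃₂ λ a' P' → P —[ boutL a' ]→ P' × a ≡ σ a' × X ≡ P' [ ext σ ]
unsub-bout (P ∣ Q) (par-l t) with unsub-bout P t
... | _ , _ , u , refl , refl = _ , _ , par-l u , refl , cong (_ ∣_) (sym (wk-sub Q))
unsub-bout (P ∣ Q) (par-r t) with unsub-bout Q t
... | _ , _ , u , refl , refl = _ , _ , par-r u , refl , cong (_∣ _) (sym (wk-sub P))
unsub-bout (ν P) (open' t) with unsub-out P t
... | suc _ , zero , _ , u , refl , refl , refl = _ , _ , open' u , refl , refl
unsub-bout (ν P) (res t) with unsub-bout P t
... | suc _ , P' , u , refl , refl = _ , _ , res u , refl , cong ν (sym (swap-sub P'))

-- What a communication between an input at a and an output at b would yield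
-- if a and b were the same name; these are the reductions a substitution can create.
data _—⟨_,_⟩→_ : Proc → Name → Name → Proc → Set where
  comm-l  : P —[ inL a ]→ P' → Q —[ outL b c ]→ Q' → (P ∣ Q) —⟨ a , b ⟩→ ((P' [ c /0]) ∣ Q')
  comm-r  : P —[ outL b c ]→ P' → Q —[ inL a ]→ Q' → (P ∣ Q) —⟨ a , b ⟩→ (P' ∣ (Q' [ c /0]))
  close-l : P —[ inL a ]→ P' → Q —[ boutL b ]→ Q' → (P ∣ Q) —⟨ a , b ⟩→ ν (P' ∣ Q')
  close-r : P —[ boutL b ]→ P' → Q —[ inL a ]→ Q' → (P ∣ Q) —⟨ a , b ⟩→ ν (P' ∣ Q')
  par-l   : P —⟨ a , b ⟩→ P' → (P ∣ Q) —⟨ a , b ⟩→ (P' ∣ Q)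
  par-r   : Q —⟨ a , b ⟩→ Q' → (P ∣ Q) —⟨ a , b ⟩→ (P ∣ Q')
  res     : P —⟨ suc a , suc b ⟩→ P' → ν P —⟨ a , b ⟩→ ν P'

infixl 4 _▹_

_▹_ : P —⟨ a , b ⟩→ X → X ≡ Y → P —⟨ a , b ⟩→ Y
t ▹ refl = t

comm⇒τ : P —⟨ a , a ⟩→ X → P —[ τ ]→ X
comm⇒τ (comm-l t u)  = comm-l t u
comm⇒τ (comm-r t u)  = comm-r t u
comm⇒τ (close-l t u) = close-l t u
comm⇒τ (close-r t u) = close-r t u
comm⇒τ (par-l t)     = par-l (comm⇒τ t)
comm⇒τ (par-r t)     = par-r (comm⇒τ t)
comm⇒τ (res t)       = res (comm⇒τ t)

sub-comm-step : P —⟨ a , b ⟩→ P' → (P [ σ ]) —⟨ σ a , σ b ⟩→ (P' [ σ ])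
sub-comm-step (comm-l {P' = P'} t u) = comm-l (sub-step t) (sub-step u) ▹ cong (_∣ _) (sym (inst-sub P'))
sub-comm-step (comm-r {Q' = Q'} t u) = comm-r (sub-step t) (sub-step u) ▹ cong (_ ∣_) (sym (inst-sub Q'))
sub-comm-step (close-l t u) = close-l (sub-step t) (sub-step u)
sub-comm-step (close-r t u) = close-r (sub-step t) (sub-step u)
sub-comm-step (par-l t)     = par-l (sub-comm-step t)
sub-comm-step (par-r t)     = par-r (sub-comm-step t)
sub-comm-step (res t)       = res (sub-comm-step t)

-- The case `created` also covers communications whose subjects agree before the substitution; only
-- their equality after it is recorded.
data SubRedex (P : Proc) (σ : Name → Name) (X : Proc) : Set where
  real    : P —[ τ ]→ P' → X ≡ P' [ σ ] → SubRedex P σ X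
  created : P —⟨ a , b ⟩→ P' → σ a ≡ σ b → X ≡ P' [ σ ] → SubRedex P σ X

unsub-τ : ∀ P → (P [ σ ]) —[ τ ]→ X → SubRedex P σ X
unsub-τ (P ∣ Q) (comm-l t u) with unsub-in P t | unsub-out Q u
... | _ , P' , t' , e , refl | _ , _ , _ , u' , refl , refl , refl =
  created (comm-l t' u') (sym e) (cong (_∣ _) (sym (inst-sub P')))
unsub-τ (P ∣ Q) (comm-r t u) with unsub-out P t | unsub-in Q u
... | _ , _ , _ , t' , e , refl , refl | _ , Q' , u' , refl , refl =
  created (comm-r t' u') e (cong (_ ∣_) (sym (inst-sub Q')))
unsub-τ (P ∣ Q) (close-l t u) with unsub-in P t | unsub-bout Q u
... | _ , _ , t' , e , refl | _ , _ , u' , refl , refl = created (close-l t' u') (sym e) refl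
unsub-τ (P ∣ Q) (close-r t u) with unsub-bout P t | unsub-in Q u
... | _ , _ , t' , e , refl | _ , _ , u' , refl , refl = created (close-r t' u') e refl
unsub-τ (P ∣ Q) (par-l t) with unsub-τ P t
... | real u refl      = real (par-l u) refl
... | created u e refl = created (par-l u) e refl
unsub-τ (P ∣ Q) (par-r t) with unsub-τ Q t
... | real u refl      = real (par-r u) refl
... | created u e refl = created (par-r u) e refl
unsub-τ (ν P) (res t) with unsub-τ P t
... | real u refl = real (res u) refl
-- Both subjects are the restricted name, which `ext σ` identifies with no other, so the reduction
-- was possible before the substitution.
... | created {a = zero}  {b = zero}  u e refl = real (res (comm⇒τ u)) refl
... | created {a = suc _} {b = suc _} u e refl = created (res u) (suc-injective e) refl

-- `suc` is injective, so weakening identifies no subjects and a created communication is a real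
-- one.
unwk-τ : ∀ P → wk P —[ τ ]→ X → ∃ λ P' → P —[ τ ]→ P' × X ≡ wk P'
unwk-τ P t with unsub-τ P t
... | real u e         = _ , u , e
... | created u refl e = _ , comm⇒τ u , e

-- Scope extrusion

-- X ↥ Y: some restriction inside X, not under a prefix, can be pulled to the
-- top, turning X into ν Y.
data _↥_ : Proc → Proc → Set where
  here  : ν Y ↥ Y
  par-l : X ↥ Y → (X ∣ Z) ↥ (Y ∣ wk Z)
  par-r : X ↥ Y → (Z ∣ X) ↥ (wk Z ∣ Y)
  under : X ↥ Y → ν X ↥ ν (Y [ swap ])

↥-resp : X ↥ Y → Y ≡ Z → X ↥ Z
↥-resp o refl = o

sub-↥ : X ↥ Y → (X [ σ ]) ↥ (Y [ ext σ ])
sub-↥ here              = here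
sub-↥ (par-l {Z = Z} o) = ↥-resp (par-l (sub-↥ o)) (cong (_ ∣_) (sym (wk-sub Z)))
sub-↥ (par-r {Z = Z} o) = ↥-resp (par-r (sub-↥ o)) (cong (_∣ _) (sym (wk-sub Z)))
sub-↥ (under {Y = Y} o) = ↥-resp (under (sub-↥ o)) (cong ν (sym (swap-sub Y)))

-- For `X ↥ Y`, a binding step of `Y` puts the name of the label at index 0 and the pulled
-- restriction at index 1; pulling the restriction out of the derivative of `X` gives the opposite
-- order.
swapIf : Bool → Proc → Proc
swapIf true  P = P [ swap ]
swapIf false P = P

swapIf-wkIf : ∀ μ → swapIf (binding μ) (wkIf (binding (shiftL μ)) (wk P)) ≡ wk (wkIf (binding μ) P)
swapIf-wkIf {P} (inL _)    = wk-wk-swap P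
swapIf-wkIf     (outL _ _) = refl
swapIf-wkIf {P} (boutL _)  = wk-wk-swap P
swapIf-wkIf     τ          = refl

swapIf-∣ : ∀ c → swapIf c (P ∣ Q) ≡ swapIf c P ∣ swapIf c Q
swapIf-∣ true  = refl
swapIf-∣ false = refl

under-swap : X ↥ (Y [ swap ]) → ν X ↥ ν Y
under-swap {Y = Y} o = ↥-resp (under o) (cong ν (swap-swap Y))

under-swap₂ : ∀ Y → X ↥ (Y [ swap ]) → ν (X [ swap ]) ↥ (ν (Y [ ext swap ] [ swap ]) [ swap ])
under-swap₂ Y o = ↥-resp (under (sub-↥ o)) (cong ν (braid Y))

↥-par-l : ∀ μ → X ↥ swapIf (binding μ) Y →
  (X ∣ wkIf (binding μ) Z) ↥ swapIf (binding μ) (Y ∣ wkIf (binding (shiftL μ)) (wk Z))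
↥-par-l μ o = ↥-resp (par-l o)
  (trans (cong (_ ∣_) (sym (swapIf-wkIf μ))) (sym (swapIf-∣ (binding μ))))

↥-par-r : ∀ μ → X ↥ swapIf (binding μ) Y →
  (wkIf (binding μ) Z ∣ X) ↥ swapIf (binding μ) (wkIf (binding (shiftL μ)) (wk Z) ∣ Y)
↥-par-r μ o = ↥-resp (par-r o)
  (trans (cong (_∣ _) (sym (swapIf-wkIf μ))) (sym (swapIf-∣ (binding μ))))

-- In `stays` the pulled restriction survives the step; in `leaves` the step extrudes exactly that
-- name, and both sides reach the same derivative.
data Step↥ (Y : Proc) (μ : Label) (X' : Proc) : Set where
  stays  : Y —[ shiftL μ ]→ P → X' ↥ swapIf (binding μ) P → Step↥ Y μ X'
  leaves : Y —[ outL (suc a) zero ]→ X' → μ ≡ boutL a → Step↥ Y μ X'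

wk-↥ : ∀ μ → X ↥ Y → wkIf (binding μ) X ↥ swapIf (binding μ) (wkIf (binding (shiftL μ)) Y)
wk-↥ {Y = Y} (inL _)    o = ↥-resp (sub-↥ o) (sym (wk-swap Y))
wk-↥         (outL _ _) o = o
wk-↥ {Y = Y} (boutL _)  o = ↥-resp (sub-↥ o) (sym (wk-swap Y))
wk-↥         τ          o = o

wk-stays-l : ∀ μ → X ↥ Y → Z —[ μ ]→ P → Step↥ (Y ∣ wk Z) μ (wkIf (binding μ) X ∣ P)
wk-stays-l {Y = Y} {P = P} (inL a)    o t = stays (par-r (sub-step t))
  (↥-resp (par-l (sub-↥ o)) (cong₂ _∣_ (sym (wk-swap Y)) (sym (ext-suc-swap P))))
wk-stays-l                 (outL a b) o t = stays (par-r (sub-step t)) (par-l o)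
wk-stays-l {Y = Y} {P = P} (boutL a)  o t = stays (par-r (sub-step t))
  (↥-resp (par-l (sub-↥ o)) (cong₂ _∣_ (sym (wk-swap Y)) (sym (ext-suc-swap P))))
wk-stays-l                 τ          o t = stays (par-r (sub-step t)) (par-l o)

wk-stays-r : ∀ μ → X ↥ Y → Z —[ μ ]→ P → Step↥ (wk Z ∣ Y) μ (P ∣ wkIf (binding μ) X)
wk-stays-r {Y = Y} {P = P} (inL a)    o t = stays (par-l (sub-step t))
  (↥-resp (par-r (sub-↥ o)) (cong₂ _∣_ (sym (ext-suc-swap P)) (sym (wk-swap Y))))
wk-stays-r                 (outL a b) o t = stays (par-l (sub-step t)) (par-r o)
wk-stays-r {Y = Y} {P = P} (boutL a)  o t = stays (par-l (sub-step t))
  (↥-resp (par-r (sub-↥ o)) (cong₂ _∣_ (sym (ext-suc-swap P)) (sym (wk-swap Y))))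
wk-stays-r                 τ          o t = stays (par-l (sub-step t)) (par-r o)

inst-↥ : ∀ Y → X ↥ (Y [ swap ]) → (X [ c /0]) ↥ (Y [ suc c /0])
inst-↥ Y o = ↥-resp (sub-↥ o) (swap-ext-inst Y)

close-↥-l : ∀ Y Z → X ↥ (Y [ swap ]) → ν (X ∣ Z) ↥ ν (Y ∣ (Z [ ext suc ]))
close-↥-l Y Z o = under-swap (↥-resp (par-l o) (cong (_ ∣_) (sym (ext-suc-swap Z))))

close-↥-r : ∀ Y Z → X ↥ (Y [ swap ]) → ν (Z ∣ X) ↥ ν ((Z [ ext suc ]) ∣ Y)
close-↥-r Y Z o = under-swap (↥-resp (par-r o) (cong (_∣ _) (sym (ext-suc-swap Z))))

here-res : ∀ c → resIf c P ↥ swapIf c P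
here-res true  = here
here-res false = here

-- The components over which the restriction is pulled are weakened, so they do not mention its name
-- and their actions are unaffected. Only a close on that name changes its form.
step-↥ : X ↥ Y → X —[ μ ]→ X' → Step↥ Y μ X'
step-↥ here (res {μ = μ} t) = stays t (here-res (binding μ))
step-↥ here (open' t)       = leaves t refl
step-↥ (par-l o) (par-l {μ = μ} t) with step-↥ o t
... | stays u o'    = stays (par-l u) (↥-par-l μ o')
... | leaves u refl = leaves (par-l u) refl
step-↥ (par-l o) (par-r t) = wk-stays-l _ o t
step-↥ (par-l o) (comm-l t u) with step-↥ o t
... | stays {P = P} t' o' = stays (comm-l t' (sub-step u)) (par-l (inst-↥ P o'))
step-↥ (par-l o) (comm-r {Q' = Q'} t u) with step-↥ o t
... | stays t' o' = stays (comm-r t' (sub-step u)) (↥-resp (par-l o') (cong (_ ∣_) (inst-sub Q')))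
step-↥ (par-l o) (close-l {Q' = Q'} t u) with step-↥ o t
... | stays {P = P} t' o' = stays (close-l t' (sub-step u)) (close-↥-l P Q' o')
step-↥ (par-l o) (close-r {Q' = Q'} t u) with step-↥ o t
... | stays {P = P} t' o' = stays (close-r t' (sub-step u)) (close-↥-l P Q' o')
-- The extruded name is the pulled one and already in scope in `Y`, where the close is a
-- communication with object `zero`.
... | leaves t' refl = stays (comm-r t' (sub-step u) ▸ cong (_ ∣_) (ext-suc-inst Q')) here
step-↥ (par-r o) (par-r {μ = μ} t) with step-↥ o t
... | stays u o'    = stays (par-r u) (↥-par-r μ o')
... | leaves u refl = leaves (par-r u) refl
step-↥ (par-r o) (par-l t) = wk-stays-r _ o t
step-↥ (par-r o) (comm-r u t) with step-↥ o t
... | stays {P = P} t' o' = stays (comm-r (sub-step u) t') (par-r (inst-↥ P o'))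
step-↥ (par-r o) (comm-l {P' = Q'} u t) with step-↥ o t
... | stays t' o' = stays (comm-l (sub-step u) t') (↥-resp (par-r o') (cong (_∣ _) (inst-sub Q')))
step-↥ (par-r o) (close-r {P' = Q'} u t) with step-↥ o t
... | stays {P = P} t' o' = stays (close-r (sub-step u) t') (close-↥-r P Q' o')
step-↥ (par-r o) (close-l {P' = Q'} u t) with step-↥ o t
... | stays {P = P} t' o' = stays (close-l (sub-step u) t') (close-↥-r P Q' o')
... | leaves t' refl = stays (comm-l (sub-step u) t' ▸ cong (_∣ _) (ext-suc-inst Q')) here
step-↥ (under o) (res {μ = inL _} t) with step-↥ o t
... | stays {P = P} u o' = stays (res (sub-step u)) (under-swap₂ P o')
step-↥ (under o) (res {μ = outL _ _} t) with step-↥ o t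
... | stays u o' = stays (res (sub-step u)) (under o')
step-↥ (under o) (res {μ = boutL _} t) with step-↥ o t
... | stays {P = P} u o' = stays (res (sub-step u)) (under-swap₂ P o')
... | leaves u refl      = leaves (res (sub-step u)) refl
step-↥ (under o) (res {μ = τ} t) with step-↥ o t
... | stays u o' = stays (res (sub-step u)) (under o')
step-↥ (under o) (open' t) with step-↥ o t
... | stays {P = P} u o' = stays (open' (sub-step u)) (↥-resp o' (sym (swap-swap P)))

-- Reflecting transitions back through a pulled restriction

under-unswap₂ : ∀ Y → X ↥ (Y [ ext swap ] [ swap ]) → ν (X [ swap ]) ↥ (ν (Y [ swap ]) [ swap ])
under-unswap₂ Y o = ↥-resp (under-swap₂ (Y [ ext swap ]) o)
  (cong (λ Z → ν (Z [ swap ]) [ swap ]) (ext-swap-swap Y))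

unstep-leave : X ↥ Y → Y —[ outL (suc a) zero ]→ P → X —[ boutL a ]→ P
unstep-leave here      t         = open' t
unstep-leave (par-l o) (par-l t) = par-l (unstep-leave o t)
unstep-leave (par-l {Z = Z} o) (par-r t) with unsub-out Z t
-- A weakened component cannot send the pulled name.
... | _ , _ , _ , _ , _ , () , _
unstep-leave (par-r o) (par-r t) = par-r (unstep-leave o t)
unstep-leave (par-r {Z = Z} o) (par-l t) with unsub-out Z t
... | _ , _ , _ , _ , _ , () , _
unstep-leave (under o) (res {P' = P'} t) =
  res (unstep-leave o (unswap-step t)) ▸ cong ν (swap-swap P')

Unstep : Proc → Label → Proc → Set
Unstep X μ Y' = ∃ λ X' → X —[ μ ]→ X' × X' ↥ swapIf (binding μ) Y'

unstep-in : X ↥ Y → Y —[ inL (suc a) ]→ P → Unstep X (inL a) P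
unstep-in here      t         = _ , res t , here
unstep-in (par-l o) (par-l t) with unstep-in o t
... | _ , u , o' = _ , par-l u , ↥-par-l (inL zero) o'
unstep-in (par-l {Z = Z} o) (par-r t) with unsub-in Z t
... | _ , Z' , u , refl , refl = _ , par-r u , ↥-resp (par-l (wk-↥ (inL zero) o)) (cong (_ ∣_) (sym (ext-suc-swap Z')))
unstep-in (par-r o) (par-r t) with unstep-in o t
... | _ , u , o' = _ , par-r u , ↥-par-r (inL zero) o'
unstep-in (par-r {Z = Z} o) (par-l t) with unsub-in Z t
... | _ , Z' , u , refl , refl = _ , par-l u , ↥-resp (par-r (wk-↥ (inL zero) o)) (cong (_∣ _) (sym (ext-suc-swap Z')))
unstep-in (under o) (res {P' = P'} t) with unstep-in o (unswap-step t)
... | _ , u , o' = _ , res u , under-unswap₂ P' o'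

unstep-out : X ↥ Y → Y —[ outL (suc a) (suc b) ]→ P → Unstep X (outL a b) P
unstep-out here      t         = _ , res t , here
unstep-out (par-l o) (par-l t) with unstep-out o t
... | _ , u , o' = _ , par-l u , par-l o'
unstep-out (par-l {Z = Z} o) (par-r t) with unsub-out Z t
... | _ , _ , _ , u , refl , refl , refl = _ , par-r u , par-l o
unstep-out (par-r o) (par-r t) with unstep-out o t
... | _ , u , o' = _ , par-r u , par-r o'
unstep-out (par-r {Z = Z} o) (par-l t) with unsub-out Z t
... | _ , _ , _ , u , refl , refl , refl = _ , par-l u , par-r o
unstep-out (under o) (res t) with unstep-out o (unswap-step t)
... | _ , u , o' = _ , res u , under-swap o'

unstep-bout : X ↥ Y → Y —[ boutL (suc a) ]→ P → Unstep X (boutL a) P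
unstep-bout here      t         = _ , res t , here
unstep-bout (par-l o) (par-l t) with unstep-bout o t
... | _ , u , o' = _ , par-l u , ↥-par-l (inL zero) o'
unstep-bout (par-l {Z = Z} o) (par-r t) with unsub-bout Z t
... | _ , Z' , u , refl , refl = _ , par-r u , ↥-resp (par-l (wk-↥ (inL zero) o)) (cong (_ ∣_) (sym (ext-suc-swap Z')))
unstep-bout (par-r o) (par-r t) with unstep-bout o t
... | _ , u , o' = _ , par-r u , ↥-par-r (inL zero) o'
unstep-bout (par-r {Z = Z} o) (par-l t) with unsub-bout Z t
... | _ , Z' , u , refl , refl = _ , par-l u , ↥-resp (par-r (wk-↥ (inL zero) o)) (cong (_∣ _) (sym (ext-suc-swap Z')))
unstep-bout (under o) (open' t) with unstep-out o (unswap-step t)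
... | _ , u , o' = _ , open' u , o'
unstep-bout (under o) (res {P' = P'} t) with unstep-bout o (unswap-step t)
... | _ , u , o' = _ , res u , under-unswap₂ P' o'

unstep-τ : X ↥ Y → Y —[ τ ]→ P → Unstep X τ P
unstep-τ here      t         = _ , res t , here
unstep-τ (par-l o) (par-l t) with unstep-τ o t
... | _ , u , o' = _ , par-l u , par-l o'
unstep-τ (par-l {Z = Z} o) (par-r t) with unwk-τ Z t
... | _ , u , refl = _ , par-r u , par-l o
unstep-τ (par-l {Z = Z} o) (comm-l {P' = P'} t u) with unsub-out Z u
... | _ , _ , _ , u' , refl , refl , refl with unstep-in o t
...   | _ , t' , o' = _ , comm-l t' u' , par-l (inst-↥ P' o')
-- Sending the pulled name to a component outside its original scope is a scope-extruding close in
-- `X`.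
unstep-τ (par-l {Z = Z} o) (comm-r {b = zero} t u) with unsub-in Z u
... | _ , Z' , u' , refl , refl =
  _ , close-r (unstep-leave o t) u' , ↥-resp here (cong (_ ∣_) (sym (ext-suc-inst Z')))
unstep-τ (par-l {Z = Z} o) (comm-r {b = suc _} t u) with unsub-in Z u
... | _ , Z' , u' , refl , refl with unstep-out o t
...   | _ , t' , o' = _ , comm-r t' u' , ↥-resp (par-l o') (cong (_ ∣_) (inst-sub Z'))
unstep-τ (par-l {Z = Z} o) (close-l {P' = P'} t u) with unsub-bout Z u
... | _ , Z' , u' , refl , refl with unstep-in o t
...   | _ , t' , o' = _ , close-l t' u' , close-↥-l P' Z' o'
unstep-τ (par-l {Z = Z} o) (close-r {P' = P'} t u) with unsub-in Z u
... | _ , Z' , u' , refl , refl with unstep-bout o t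
...   | _ , t' , o' = _ , close-r t' u' , close-↥-l P' Z' o'
unstep-τ (par-r o) (par-r t) with unstep-τ o t
... | _ , u , o' = _ , par-r u , par-r o'
unstep-τ (par-r {Z = Z} o) (par-l t) with unwk-τ Z t
... | _ , u , refl = _ , par-l u , par-r o
unstep-τ (par-r {Z = Z} o) (comm-r {Q' = P'} u t) with unsub-out Z u
... | _ , _ , _ , u' , refl , refl , refl with unstep-in o t
...   | _ , t' , o' = _ , comm-r u' t' , par-r (inst-↥ P' o')
unstep-τ (par-r {Z = Z} o) (comm-l {b = zero} u t) with unsub-in Z u
... | _ , Z' , u' , refl , refl =
  _ , close-l u' (unstep-leave o t) , ↥-resp here (cong (_∣ _) (sym (ext-suc-inst Z')))
unstep-τ (par-r {Z = Z} o) (comm-l {b = suc _} u t) with unsub-in Z u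
... | _ , Z' , u' , refl , refl with unstep-out o t
...   | _ , t' , o' = _ , comm-l u' t' , ↥-resp (par-r o') (cong (_∣ _) (inst-sub Z'))
unstep-τ (par-r {Z = Z} o) (close-r {Q' = P'} u t) with unsub-bout Z u
... | _ , Z' , u' , refl , refl with unstep-in o t
...   | _ , t' , o' = _ , close-r u' t' , close-↥-r P' Z' o'
unstep-τ (par-r {Z = Z} o) (close-l {Q' = P'} u t) with unsub-in Z u
... | _ , Z' , u' , refl , refl with unstep-bout o t
...   | _ , t' , o' = _ , close-l u' t' , close-↥-r P' Z' o'
unstep-τ (under o) (res t) with unstep-τ o (unswap-step t)
... | _ , u , o' = _ , res u , under-swap o'

unstep : ∀ μ → X ↥ Y → Y —[ shiftL μ ]→ P → Unstep X μ P
unstep (inL _)    = unstep-in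
unstep (outL _ _) = unstep-out
unstep (boutL _)  = unstep-bout
unstep τ          = unstep-τ

-- Erasure to parallel compositions of prefix trees

data Polarity : Set where
  ι ο : Polarity

opp : Polarity → Polarity
opp ι = ο
opp ο = ι

data Tree : Set where
  ε    : Tree
  node : Polarity → Tree → Tree
  _∥_  : Tree → Tree → Tree

private variable
  s t s' t' : Tree
  p q : Polarity

data _⇝[_]_ : Tree → Polarity → Tree → Set where
  node : node p t ⇝[ p ] t
  left : s ⇝[ p ] s' → (s ∥ t) ⇝[ p ] (s' ∥ t)
  right : t ⇝[ p ] t' → (s ∥ t) ⇝[ p ] (s ∥ t')

-- Consume a forest in phases of alternating polarity, each phase firing prefixes
-- of its polarity until none is left at the top.  remains p k counts the prefixes
-- that survive k phases, the first of polarity p, among the components whose root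
-- has polarity p; rest p k is the same count among all components, those with the
-- other root being untouched by the first phase.
remains : Polarity → ℕ → Tree → ℕ
rest    : Polarity → ℕ → Tree → ℕ

remains p k       ε          = 0
remains p k       (s ∥ t)    = remains p k s + remains p k t
remains ι zero    (node ι t) = suc (rest ι zero t)
remains ι (suc k) (node ι t) = rest ι (suc k) t
remains ι k       (node ο t) = 0
remains ο zero    (node ο t) = suc (rest ο zero t)
remains ο (suc k) (node ο t) = rest ο (suc k) t
remains ο k       (node ι t) = 0

rest p zero    t = remains p zero t + remains (opp p) zero t
rest p (suc k) t = remains p (suc k) t + remains (opp p) k t

size : Tree → ℕ
size = rest ι zero

rest-zero : ∀ p t → rest p zero t ≡ size t
rest-zero ι t = refl
rest-zero ο t = +-comm (remains ο 0 t) _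

rest-∥ : ∀ p k s t → rest p k (s ∥ t) ≡ rest p k s + rest p k t
rest-∥ p zero    s t = interchange (remains p zero s) (remains p zero t) _ _
rest-∥ p (suc k) s t = interchange (remains p (suc k) s) (remains p (suc k) t) _ _

size-node : ∀ p t → size (node p t) ≡ suc (size t)
size-node ι t = +-identityʳ _
size-node ο t = cong suc (rest-zero ο t)

step-size : s ⇝[ p ] t → size s ≡ suc (size t)
step-size (node {p} {t}) = size-node p t
step-size (left {s} {s' = s'} {t = t} x) = trans (rest-∥ ι 0 s t)
  (trans (cong (_+ size t) (step-size x)) (cong suc (sym (rest-∥ ι 0 s' t))))
step-size (right {t} {t' = t'} {s = s} x) = trans (rest-∥ ι 0 s t)
  (trans (cong (size s +_) (step-size x)) (trans (+-suc _ _) (cong suc (sym (rest-∥ ι 0 s t')))))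

-- Firing a prefix of polarity `p` is part of the first phase, which fires all such prefixes anyway.
step-rest : ∀ k → s ⇝[ p ] t → rest p (suc k) s ≡ rest p (suc k) t
step-rest zero    (node {ι}) = +-identityʳ _
step-rest (suc k) (node {ι}) = +-identityʳ _
step-rest zero    (node {ο}) = +-identityʳ _
step-rest (suc k) (node {ο}) = +-identityʳ _
step-rest k (left {s} {p} {s'} {t} x) = trans (rest-∥ p (suc k) s t)
  (trans (cong (_+ rest p (suc k) t) (step-rest k x)) (sym (rest-∥ p (suc k) s' t)))
step-rest k (right {t} {p} {t'} {s} x) = trans (rest-∥ p (suc k) s t)
  (trans (cong (rest p (suc k) s +_) (step-rest k x)) (sym (rest-∥ p (suc k) s t')))

can-step : ∀ p s → (∃ λ s' → s ⇝[ p ] s') ⊎ (∀ k → remains p k s ≡ 0)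
can-step p ε          = inj₂ λ _ → refl
can-step ι (node ι t) = inj₁ (_ , node)
can-step ο (node ο t) = inj₁ (_ , node)
can-step ι (node ο t) = inj₂ λ { zero → refl ; (suc k) → refl }
can-step ο (node ι t) = inj₂ λ { zero → refl ; (suc k) → refl }
can-step p (s ∥ t) with can-step p s | can-step p t
... | inj₁ (_ , x) | _            = inj₁ (_ , left x)
... | inj₂ _       | inj₁ (_ , y) = inj₁ (_ , right y)
... | inj₂ f       | inj₂ g       = inj₂ λ k → cong₂ _+_ (f k) (g k)

-- With no component of root `p` the first phase is idle, and the remaining `k` phases begin with
-- the opposite polarity.
rest-blocked : ∀ p k → (∀ j → remains p j s ≡ 0) → rest p (suc k) s ≡ rest (opp p) k s
rest-blocked {s} p k f = trans (cong (_+ remains (opp p) k s) (f (suc k))) (sym (absorb p k f))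
  where
  drop : ∀ m {n} → n ≡ 0 → m + n ≡ m
  drop m refl = +-identityʳ m

  absorb : ∀ p k → (∀ j → remains p j s ≡ 0) → rest (opp p) k s ≡ remains (opp p) k s
  absorb ι zero    f = drop _ (f 0)
  absorb ι (suc k) f = drop _ (f k)
  absorb ο zero    f = drop _ (f 0)
  absorb ο (suc k) f = drop _ (f k)

progress : ∀ s → (∃₂ λ p s' → s ⇝[ p ] s') ⊎ size s ≡ 0
progress s with can-step ι s | can-step ο s
... | inj₁ (_ , x) | _            = inj₁ (_ , _ , x)
... | inj₂ _       | inj₁ (_ , x) = inj₁ (_ , _ , x)
... | inj₂ f       | inj₂ g       = inj₂ (cong₂ _+_ (f 0) (g 0))

-- A component rooted at the polarity of the current phase loses at least its root, and what
-- survives is rooted at the polarity of the next phase. So every phase costs a prefix.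
remains-vanishes : ∀ p k t → size t ≤ k → remains p k t ≡ 0
remains-vanishes p k       ε          _ = refl
remains-vanishes p k       (s ∥ t)    h = cong₂ _+_
  (remains-vanishes p k s (m+n≤o⇒m≤o (size s) h'))
  (remains-vanishes p k t (m+n≤o⇒n≤o (size s) h'))
  where h' = subst (_≤ k) (rest-∥ ι 0 s t) h
remains-vanishes p k (node q t) h with subst (_≤ k) (size-node q t) h
remains-vanishes ι (suc k) (node ι t) h | s≤s h' = cong₂ _+_
  (remains-vanishes ι (suc k) t (m≤n⇒m≤1+n h')) (remains-vanishes ο k t h')
remains-vanishes ο (suc k) (node ο t) h | s≤s h' = cong₂ _+_
  (remains-vanishes ο (suc k) t (m≤n⇒m≤1+n h')) (remains-vanishes ι k t h')
remains-vanishes ι (suc k) (node ο t) h | _ = refl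
remains-vanishes ο (suc k) (node ι t) h | _ = refl

-- Bisimilar trees have equal phase counts

module _ {B : Tree → Tree → Set} (B-sym : ∀ {s t} → B s t → B t s)
         (B-sim : ∀ {p s t s'} → B s t → s ⇝[ p ] s' → ∃ λ t' → t ⇝[ p ] t' × B s' t') where

  private
    step-pred : ∀ {n} → s ⇝[ p ] s' → size s ≡ suc n → size s' ≡ n
    step-pred x e = suc-injective (trans (sym (step-size x)) e)

    -- Every step removes one prefix and a tree without steps has size 0, so running both trees in
    -- lockstep compares their sizes. `n` is the measure of the induction.
    size-inv : ∀ n → size s ≡ n → B s t → size s ≡ size t
    size-inv {s} {t} n e r with progress s | progress t
    size-inv zero    e r | inj₁ (_ , _ , x) | _ with () ← trans (sym e) (step-size x)
    size-inv (suc n) e r | inj₁ (_ , _ , x) | _ with B-sim r x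
    ... | _ , y , r' = trans (step-size x) (trans (cong suc (size-inv n (step-pred x e) r')) (sym (step-size y)))
    size-inv n e r | inj₂ s≡0 | inj₁ (_ , _ , y) with B-sim (B-sym r) y
    ... | _ , x , _ with () ← trans (sym s≡0) (step-size x)
    size-inv n e r | inj₂ s≡0 | inj₂ t≡0 = trans s≡0 (sym t≡0)

    -- Both trees go through the phases in lockstep: while one can fire `p`, so can the other, and
    -- once both are blocked the next phase begins. Steps lower `n`, phase changes lower `k`.
    rest-inv : ∀ p k n → size s ≡ n → B s t → rest p k s ≡ rest p k t
    rest-inv {s} {t} p zero n e r =
      trans (rest-zero p s) (trans (size-inv n e r) (sym (rest-zero p t)))
    rest-inv {s} {t} p (suc k) n e r with can-step p s
    rest-inv p (suc k) zero e r | inj₁ (_ , x) with () ← trans (sym e) (step-size x)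
    rest-inv p (suc k) (suc n) e r | inj₁ (_ , x) with B-sim r x
    ... | _ , y , r' = trans (step-rest k x) (trans
      (rest-inv p (suc k) n (step-pred x e) r') (sym (step-rest k y)))
    rest-inv {s} {t} p (suc k) n e r | inj₂ f with can-step p t
    ... | inj₂ g = trans (rest-blocked p k f) (trans (rest-inv (opp p) k n e r) (sym (rest-blocked p k g)))
    rest-inv p (suc k) zero e r | inj₂ f | inj₁ (_ , y)
      with _ , x , _ ← B-sim (B-sym r) y with () ← trans (sym e) (step-size x)
    rest-inv p (suc k) (suc n) e r | inj₂ f | inj₁ (_ , y) with B-sim (B-sym r) y
    ... | _ , x , r' = trans (step-rest k x) (trans
      (rest-inv p (suc k) n (step-pred x e) (B-sym r')) (sym (step-rest k y)))

  -- `rest` adds the counts for the two root polarities. To separate them, the induction descends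
  -- from so many phases that `remains` vanishes: `rest` with one more phase and the opposite
  -- polarity is invariant, and so is its first summand, hence also the second.
  remains-inv : ∀ p k → B s t → remains p k s ≡ remains p k t
  -- `size s` extra phases exhaust `t` too, since the sizes agree.
  remains-inv {s} {t} p k r = descend (size s) p k (m≤m+n _ k)
    (subst (_≤ size s + k) (size-inv _ refl r) (m≤m+n _ k))
    where
    descend : ∀ j p k → size s ≤ j + k → size t ≤ j + k → remains p k s ≡ remains p k t
    descend zero p k hs ht = trans (remains-vanishes p k s hs) (sym (remains-vanishes p k t ht))
    descend (suc j) ι k hs ht = +-cancelˡ-≡ (remains ο (suc k) s) _ _
      (trans (rest-inv ο (suc k) _ refl r) (cong (_+ remains ι k t) (sym
        (descend j ο (suc k) (subst (size s ≤_) (sym (+-suc j k)) hs) (subst (size t ≤_) (sym (+-suc j k)) ht)))))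
    descend (suc j) ο k hs ht = +-cancelˡ-≡ (remains ι (suc k) s) _ _
      (trans (rest-inv ι (suc k) _ refl r) (cong (_+ remains ο k t) (sym
        (descend j ι (suc k) (subst (size s ≤_) (sym (+-suc j k)) hs) (subst (size t ≤_) (sym (+-suc j k)) ht)))))

-- Erasing processes and their transitions

private variable
  ℓ ℓ' : Name → Bool

dead : (Name → Bool) → Name → Bool
dead ℓ zero    = false
dead ℓ (suc n) = ℓ n

-- A prefix with a bound subject is dropped with its continuation: a restricted
-- subject cannot be observed, and received or extruded names are ignored alike.
erase : (Name → Bool) → Proc → Tree
erase ℓ 𝟘           = ε
erase ℓ (inp m P)   = if ℓ m then node ι (erase (dead ℓ) P) else ε
erase ℓ (out m n P) = if ℓ m then node ο (erase ℓ P) else ε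
erase ℓ (P ∣ Q)     = erase ℓ P ∥ erase ℓ Q
erase ℓ (ν P)       = erase (dead ℓ) P

dead-ext : ℓ ∘ σ ≗ ℓ' → dead ℓ ∘ ext σ ≗ dead ℓ'
dead-ext e zero    = refl
dead-ext e (suc n) = e n

erase-sub : ∀ P → ℓ ∘ σ ≗ ℓ' → erase ℓ (P [ σ ]) ≡ erase ℓ' P
erase-sub 𝟘           e = refl
erase-sub (inp m P)   e = cong₂ (λ b t → if b then node ι t else ε) (e m) (erase-sub P (dead-ext e))
erase-sub (out m n P) e = cong₂ (λ b t → if b then node ο t else ε) (e m) (erase-sub P e)
erase-sub (P ∣ Q)     e = cong₂ _∥_ (erase-sub P e) (erase-sub Q e)
erase-sub (ν P)       e = erase-sub P (dead-ext e)

erase-wk : ∀ P → erase (dead ℓ) (wk P) ≡ erase ℓ P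
erase-wk P = erase-sub P (λ _ → refl)

erase-swap : ∀ P → erase (dead (dead ℓ)) (P [ swap ]) ≡ erase (dead (dead ℓ)) P
erase-swap P = erase-sub P λ { zero → refl ; (suc zero) → refl ; (suc (suc n)) → refl }

infixl 4 _▷_

_▷_ : s ⇝[ p ] t → t ≡ t' → s ⇝[ p ] t'
x ▷ refl = x

erase-in : ℓ a ≡ true → P —[ inL a ]→ P' → erase ℓ P ⇝[ ι ] erase (dead ℓ) P'
erase-in l pre-in rewrite l = node
erase-in l (par-l {Q = Q} t)  = left (erase-in l t) ▷ cong (_ ∥_) (sym (erase-wk Q))
erase-in l (par-r {P = P} t)  = right (erase-in l t) ▷ cong (_∥ _) (sym (erase-wk P))
erase-in l (res {P' = P'} t)  = erase-in l t ▷ sym (erase-swap P')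

erase-out : ℓ a ≡ true → P —[ outL a b ]→ P' → erase ℓ P ⇝[ ο ] erase ℓ P'
erase-out l pre-out rewrite l = node
erase-out l (par-l t) = left (erase-out l t)
erase-out l (par-r t) = right (erase-out l t)
erase-out l (res t)   = erase-out l t

erase-bout : ℓ a ≡ true → P —[ boutL a ]→ P' → erase ℓ P ⇝[ ο ] erase (dead ℓ) P'
erase-bout l (par-l {Q = Q} t)  = left (erase-bout l t) ▷ cong (_ ∥_) (sym (erase-wk Q))
erase-bout l (par-r {P = P} t)  = right (erase-bout l t) ▷ cong (_∥ _) (sym (erase-wk P))
erase-bout l (open' t)          = erase-out l t
erase-bout l (res {P' = P'} t)  = erase-bout l t ▷ sym (erase-swap P')

-- A prefix that survives erasure has a live subject, which no enclosing restriction binds, so its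
-- action is visible.
unerase-in : ∀ P → erase ℓ P ⇝[ ι ] t →
  ∃₂ λ a P' → ℓ a ≡ true × P —[ inL a ]→ P' × t ≡ erase (dead ℓ) P'
unerase-in {ℓ} (inp m P) x with ℓ m in l
unerase-in (inp m P) node | true = _ , _ , l , pre-in , refl
unerase-in {ℓ} (out m n P) x with ℓ m
unerase-in (out m n P) () | true
unerase-in (out m n P) () | false
unerase-in (P ∣ Q) (left x) with unerase-in P x
... | _ , _ , l , u , refl = _ , _ , l , par-l u , cong (_ ∥_) (sym (erase-wk Q))
unerase-in (P ∣ Q) (right x) with unerase-in Q x
... | _ , _ , l , u , refl = _ , _ , l , par-r u , cong (_∥ _) (sym (erase-wk P))
unerase-in (ν P) x with unerase-in P x
... | suc _ , P' , l , u , refl = _ , _ , l , res u , sym (erase-swap P')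

-- Erasure forgets objects, so an output node may stem from a free or a bound output.
data Output (ℓ : Name → Bool) (P : Proc) (t : Tree) : Set where
  free  : ℓ a ≡ true → P —[ outL a b ]→ P' → t ≡ erase ℓ P' → Output ℓ P t
  bound : ℓ a ≡ true → P —[ boutL a ]→ P' → t ≡ erase (dead ℓ) P' → Output ℓ P t

unerase-out : ∀ P → erase ℓ P ⇝[ ο ] t → Output ℓ P t
unerase-out {ℓ} (out m n P) x with ℓ m in l
unerase-out (out m n P) node | true = free l pre-out refl
unerase-out {ℓ} (inp m P) x with ℓ m
unerase-out (inp m P) () | true
unerase-out (inp m P) () | false
unerase-out (P ∣ Q) (left x) with unerase-out P x
... | free l u refl  = free l (par-l u) refl
... | bound l u refl = bound l (par-l u) (cong (_ ∥_) (sym (erase-wk Q)))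
unerase-out (P ∣ Q) (right x) with unerase-out Q x
... | free l u refl  = free l (par-r u) refl
... | bound l u refl = bound l (par-r u) (cong (_∥ _) (sym (erase-wk P)))
unerase-out (ν P) x with unerase-out P x
... | free {suc _} {zero}  l u refl = bound l (open' u) refl
... | free {suc _} {suc _} l u refl = free l (res u) refl
... | bound {suc _} {P'} l u refl   = bound l (res u) (sym (erase-swap P'))

-- The total size of the input-rooted components.
weight : (Name → Bool) → Proc → ℕ
weight ℓ P = remains ι 0 (erase ℓ P)

weight-wk : ∀ P → weight (dead ℓ) (wk P) ≡ weight ℓ P
weight-wk P = cong (remains ι 0) (erase-wk P)

weight-wk₂ : ∀ P → weight (dead (dead ℓ)) (wk (wk P)) ≡ weight ℓ P
weight-wk₂ P = trans (weight-wk (wk P)) (weight-wk P)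

weight-swap : ∀ P → weight (dead (dead ℓ)) (P [ swap ]) ≡ weight (dead (dead ℓ)) P
weight-swap P = cong (remains ι 0) (erase-swap P)

erase-ext-swap : ∀ P → erase (dead (dead (dead ℓ))) (P [ ext swap ]) ≡ erase (dead (dead (dead ℓ))) P
erase-ext-swap P = erase-sub P
  λ { zero → refl ; (suc zero) → refl ; (suc (suc zero)) → refl ; (suc (suc (suc n))) → refl }

-- Two orders of firing an input and an output

-- Y is reached by the input and the bound output one after the other; its two
-- topmost names, received and extruded, are identified by the communication.
record Extruding (P : Proc) (a b : Name) (Y : Proc) : Set where
  constructor extruding
  field
    {result} : Proc
    comm     : P —⟨ a , b ⟩→ result
    pulled   : result ↥ (Y [ zero /0])

-- `suc (size s)` is the weight of an input prefix with erased continuation `s`. Weight never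
-- exceeds size, and a step lowers the size.
guarded-weight : s ⇝[ p ] t → remains ι 0 t < suc (size s)
guarded-weight x = s≤s (≤-trans (m≤m+n _ _) (≤-trans (n≤1+n _) (≤-reflexive (sym (step-size x)))))

-- If the two actions come from different sides of a parallel composition, they form a
-- communication. Otherwise the output lies below the input prefix: that component loses weight and
-- all others keep theirs.
in-out : ℓ a ≡ true → ℓ b ≡ true → P —[ inL a ]→ P' → P' —[ outL (suc b) (suc c) ]→ Q →
  P —⟨ a , b ⟩→ (Q [ c /0]) ⊎ weight (dead ℓ) Q < weight ℓ P
in-out l m pre-in u rewrite l = inj₂ (guarded-weight (erase-out m u))
in-out {ℓ} l m (par-l {Q = Z} t) (par-l u) with in-out {ℓ} l m t u
... | inj₁ v = inj₁ (par-l v ▹ cong (_ ∣_) (sym (wk-inst Z)))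
... | inj₂ w = inj₂ (+-mono-<-≤ w (≤-reflexive (weight-wk Z)))
in-out l m (par-l {Q = Z} t) (par-r u) with unsub-out Z u
... | _ , _ , Z' , u' , refl , refl , refl = inj₁ (comm-l t u' ▹ cong (_ ∣_) (sym (wk-inst Z')))
in-out {ℓ} l m (par-r {P = Z} t) (par-r u) with in-out {ℓ} l m t u
... | inj₁ v = inj₁ (par-r v ▹ cong (_∣ _) (sym (wk-inst Z)))
... | inj₂ w = inj₂ (+-mono-≤-< (≤-reflexive (weight-wk Z)) w)
in-out l m (par-r {P = Z} t) (par-l u) with unsub-out Z u
... | _ , _ , Z' , u' , refl , refl , refl = inj₁ (comm-r u' t ▹ cong (_∣ _) (sym (wk-inst Z')))
in-out {ℓ} {c = c} l m (res t) (res {P' = P'} u) with in-out {dead ℓ} l m t (unswap-step u)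
... | inj₁ v = inj₁ (res v ▹ cong ν
  (trans (sym (swap-ext-inst (P' [ swap ]))) (cong (_[ ext (inst c) ]) (swap-swap P'))))
... | inj₂ w = inj₂ (subst (_< _) (weight-swap P') w)

in-bout : ℓ a ≡ true → ℓ b ≡ true → P —[ inL a ]→ P' → P' —[ boutL (suc b) ]→ Q →
  Extruding P a b Q ⊎ weight (dead (dead ℓ)) Q < weight ℓ P
in-bout l m pre-in u rewrite l = inj₂ (guarded-weight (erase-bout m u))
in-bout {ℓ} l m (par-l {Q = Z} t) (par-l u) with in-bout {ℓ} l m t u
... | inj₁ (extruding v o) = inj₁ (extruding (par-l v) (↥-resp (par-l o) (cong (_ ∣_) (sym (wk-inst (wk Z))))))
... | inj₂ w = inj₂ (+-mono-<-≤ w (≤-reflexive (weight-wk₂ Z)))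
in-bout l m (par-l {P' = P'} {Q = Z} t) (par-r u) with unsub-bout Z u
... | _ , Z' , u' , refl , refl =
  inj₁ (extruding (close-l t u') (↥-resp here (cong₂ _∣_ (sym (wk-inst P')) (sym (ext-suc-inst Z')))))
in-bout {ℓ} l m (par-r {P = Z} t) (par-r u) with in-bout {ℓ} l m t u
... | inj₁ (extruding v o) = inj₁ (extruding (par-r v) (↥-resp (par-r o) (cong (_∣ _) (sym (wk-inst (wk Z))))))
... | inj₂ w = inj₂ (+-mono-≤-< (≤-reflexive (weight-wk₂ Z)) w)
in-bout l m (par-r {P = Z} {Q' = P'} t) (par-l u) with unsub-bout Z u
... | _ , Z' , u' , refl , refl =
  inj₁ (extruding (close-r u' t) (↥-resp here (cong₂ _∣_ (sym (ext-suc-inst Z')) (sym (wk-inst P')))))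
-- Below the restriction the extruded name is free, so the free case applies with this name as
-- object.
in-bout {ℓ} l m (res t) (open' {P' = P'} u) with in-out {dead ℓ} l m t (unswap-step u)
... | inj₁ v = inj₁ (extruding (res v) (↥-resp here (swap-inst P')))
... | inj₂ w = inj₂ (subst (_< _) (weight-swap P') w)
in-bout {ℓ} l m (res t) (res {P' = P'} u) with in-bout {dead ℓ} l m t (unswap-step u)
... | inj₁ (extruding v o) = inj₁ (extruding (res v) (↥-resp (under o) (cong ν (ext-swap-inst-swap P'))))
... | inj₂ w = inj₂ (subst (_< _) (cong (remains ι 0) (trans (erase-ext-swap P') (sym (erase-swap P')))) w)

-- An output-rooted component has weight 0, so firing an output and then an input below it cannot
-- lower the weight.
out-in : P —[ outL b c ]→ P' → P' —[ inL a ]→ Q →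
  P —⟨ a , b ⟩→ (Q [ c /0]) ⊎ weight ℓ P ≤ weight (dead ℓ) Q
out-in {b = b} {ℓ = ℓ} pre-out u with ℓ b
... | true  = inj₂ z≤n
... | false = inj₂ z≤n
out-in {ℓ = ℓ} (par-l {Q = Z} t) (par-l u) with out-in {ℓ = ℓ} t u
... | inj₁ v = inj₁ (par-l v ▹ cong (_ ∣_) (sym (wk-inst Z)))
... | inj₂ w = inj₂ (+-mono-≤ w (≤-reflexive (sym (weight-wk Z))))
out-in (par-l {P' = P'} t) (par-r u) = inj₁ (comm-r t u ▹ cong (_∣ _) (sym (wk-inst P')))
out-in {ℓ = ℓ} (par-r {P = Z} t) (par-r u) with out-in {ℓ = ℓ} t u
... | inj₁ v = inj₁ (par-r v ▹ cong (_∣ _) (sym (wk-inst Z)))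
... | inj₂ w = inj₂ (+-mono-≤ (≤-reflexive (sym (weight-wk Z))) w)
out-in (par-r {Q' = P'} t) (par-l u) = inj₁ (comm-l u t ▹ cong (_ ∣_) (sym (wk-inst P')))
out-in {ℓ = ℓ} (res t) (res {P' = P'} u) with out-in {ℓ = dead ℓ} t u
... | inj₁ v = inj₁ (res v ▹ cong ν (sym (swap-ext-inst P')))
... | inj₂ w = inj₂ (subst (_ ≤_) (sym (weight-swap P')) w)

bout-in : P —[ boutL b ]→ P' → P' —[ inL (suc a) ]→ Q →
  Extruding P a b Q ⊎ weight ℓ P ≤ weight (dead (dead ℓ)) Q
bout-in {ℓ = ℓ} (par-l {Q = Z} t) (par-l u) with bout-in {ℓ = ℓ} t u
... | inj₁ (extruding v o) = inj₁ (extruding (par-l v) (↥-resp (par-l o) (cong (_ ∣_) (sym (wk-inst (wk Z))))))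
... | inj₂ w = inj₂ (+-mono-≤ w (≤-reflexive (sym (weight-wk₂ Z))))
bout-in (par-l {P' = P'} {Q = Z} t) (par-r u) with unsub-in Z u
... | _ , Z' , u' , refl , refl =
  inj₁ (extruding (close-r t u') (↥-resp here (cong₂ _∣_ (sym (wk-inst P')) (sym (ext-suc-inst Z')))))
bout-in {ℓ = ℓ} (par-r {P = Z} t) (par-r u) with bout-in {ℓ = ℓ} t u
... | inj₁ (extruding v o) = inj₁ (extruding (par-r v) (↥-resp (par-r o) (cong (_∣ _) (sym (wk-inst (wk Z))))))
... | inj₂ w = inj₂ (+-mono-≤ (≤-reflexive (sym (weight-wk₂ Z))) w)
bout-in (par-r {P = Z} {Q' = P'} t) (par-l u) with unsub-in Z u
... | _ , Z' , u' , refl , refl =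
  inj₁ (extruding (close-l u' t) (↥-resp here (cong₂ _∣_ (sym (ext-suc-inst Z')) (sym (wk-inst P')))))
bout-in {ℓ = ℓ} (open' t) u with out-in {ℓ = dead ℓ} t u
... | inj₁ v = inj₁ (extruding (res v) here)
... | inj₂ w = inj₂ w
bout-in {ℓ = ℓ} (res t) (res {P' = P'} u) with bout-in {ℓ = dead ℓ} t (unswap-step u)
... | inj₁ (extruding v o) = inj₁ (extruding (res v) (↥-resp (under o) (cong ν (ext-swap-inst-swap P'))))
... | inj₂ w = inj₂ (subst (_ ≤_) (cong (remains ι 0) (trans (erase-ext-swap P') (sym (erase-swap P')))) w)

-- The two actions of a communication can fire in either order. In `bound` the received and the
-- extruded name are then bound in opposite orders, hence the `swap`.
data Sequential (P : Proc) (a b : Name) (X : Proc) : Set where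
  free  : P —[ inL a ]→ P' → P' —[ outL (suc b) (suc c) ]→ Y →
          P —[ outL b c ]→ Q' → Q' —[ inL a ]→ Y →
          X ≡ Y [ c /0] → Sequential P a b X
  bound : P —[ inL a ]→ P' → P' —[ boutL (suc b) ]→ Y →
          P —[ boutL b ]→ Q' → Q' —[ inL (suc a) ]→ (Y [ swap ]) →
          X ↥ (Y [ zero /0]) → Sequential P a b X

sequentialise : P —⟨ a , b ⟩→ X → Sequential P a b X
sequentialise (comm-l {Q' = Q'} t u) =
  free (par-l t) (par-r (sub-step u)) (par-r u) (par-l t) (cong (_ ∣_) (sym (wk-inst Q')))
sequentialise (comm-r {P' = P'} t u) =
  free (par-r u) (par-l (sub-step t)) (par-l t) (par-r u) (cong (_∣ _) (sym (wk-inst P')))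
sequentialise (close-l {P' = P'} {Q' = Q'} t u) =
  bound (par-l t) (par-r (sub-step u))
    (par-r u) (par-l (sub-step t) ▸ sym (cong₂ _∣_ (wk-swap P') (ext-suc-swap Q')))
    (↥-resp here (sym (cong₂ _∣_ (wk-inst P') (ext-suc-inst Q'))))
sequentialise (close-r {P' = P'} {Q' = Q'} t u) =
  bound (par-r u) (par-l (sub-step t))
    (par-l t) (par-r (sub-step u) ▸ sym (cong₂ _∣_ (ext-suc-swap P') (wk-swap Q')))
    (↥-resp here (sym (cong₂ _∣_ (ext-suc-inst P') (wk-inst Q'))))
sequentialise (par-l {Q = Z} v) with sequentialise v
... | free t t' u u' refl = free (par-l t) (par-l t') (par-l u) (par-l u') (cong (_ ∣_) (sym (wk-inst Z)))
... | bound t t' u u' o   = bound (par-l t) (par-l t')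
  (par-l u) (par-l u' ▸ cong (_ ∣_) (sym (wk-wk-swap Z))) (↥-resp (par-l o) (cong (_ ∣_) (sym (wk-inst (wk Z)))))
sequentialise (par-r {P = Z} v) with sequentialise v
... | free t t' u u' refl = free (par-r t) (par-r t') (par-r u) (par-r u') (cong (_∣ _) (sym (wk-inst Z)))
... | bound t t' u u' o   = bound (par-r t) (par-r t')
  (par-r u) (par-r u' ▸ cong (_∣ _) (sym (wk-wk-swap Z))) (↥-resp (par-r o) (cong (_∣ _) (sym (wk-inst (wk Z)))))
sequentialise (res v) with sequentialise v
-- The object is the restricted name, so the free output becomes a bound one.
... | free {c = zero} {Y = Y} t t' u u' refl = bound (res t) (open' (sub-step t'))
  (open' u) (u' ▸ sym (swap-swap Y)) (↥-resp here (sym (swap-inst Y)))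
... | free {c = suc c} {Y = Y} t t' u u' refl = free (res t) (res (sub-step t'))
  (res u) (res u') (cong ν (sym (swap-ext-inst Y)))
... | bound {Y = Y} t t' u u' o = bound (res t) (res (sub-step t'))
  (res u) (res (sub-step u') ▸ cong ν (braid Y))
  (↥-resp (under o) (cong ν (inst-swap Y)))

-- A bisimulation containing all substitution instances

all-live : Name → Bool
all-live _ = true

module _ {S : Rel} (S-sym : Symmetric S)
         (S-sim : ∀ {P Q μ P'} → S P Q → P —[ μ ]→ P' → Σ Proc λ Q' → (Q —[ μ ]→ Q') × S P' Q') where

  -- A bisimulation on trees. `ℓ` varies because each input or bound output adds a dead name.
  data Erased : Tree → Tree → Set where
    erased : S P Q → Erased (erase ℓ P) (erase ℓ Q)

  Erased-sym : Erased s t → Erased t s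
  Erased-sym (erased r) = erased (S-sym r)

  Erased-sim : Erased s t → s ⇝[ p ] s' → ∃ λ t' → t ⇝[ p ] t' × Erased s' t'
  Erased-sim {p = ι} (erased {P} r) x with unerase-in P x
  ... | _ , _ , l , u , refl with S-sim r u
  ...   | _ , v , r' = _ , erase-in l v , erased r'
  Erased-sim {p = ο} (erased {P} r) x with unerase-out P x
  ... | free l u refl with S-sim r u
  ...   | _ , v , r' = _ , erase-out l v , erased r'
  Erased-sim {p = ο} (erased {P} r) x | bound l u refl with S-sim r u
  ...   | _ , v , r' = _ , erase-bout l v , erased r'

  weight-inv : S P Q → weight ℓ P ≡ weight ℓ Q
  weight-inv r = remains-inv Erased-sym Erased-sim ι 0 (erased r)

  -- Matching closes may leave their restrictions at different depths in the two processes;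
  -- `extruded` compares them after pulling both to the top.
  data Closure : Rel where
    instances : S P Q → Closure (P [ σ ]) (Q [ σ ])
    extruded  : X ↥ P → Y ↥ Q → Closure P Q → Closure X Y

  Closure-sym : Symmetric Closure
  Closure-sym (instances r)    = instances (S-sym r)
  Closure-sym (extruded o o' r) = extruded o' o (Closure-sym r)

  Closure-sub : Closure P Q → Closure (P [ σ ]) (Q [ σ ])
  Closure-sub (instances {P} {Q} r) = subst₂ Closure (sym (sub-∘ P)) (sym (sub-∘ Q)) (instances r)
  Closure-sub (extruded o o' r)     = extruded (sub-↥ o) (sub-↥ o') (Closure-sub r)

  Closure-swapIf : ∀ c → Closure P Q → Closure (swapIf c P) (swapIf c Q)
  Closure-swapIf true  r = Closure-sub r
  Closure-swapIf false r = r

  -- If Q cannot perform the communication, then it unguards the output by the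
  -- input in one order, and the input by the output in the other: the weight
  -- decreases in the first case but not in the second, although the two
  -- derivatives have the same weight.
  match-comm : S P Q → P —⟨ a , b ⟩→ X → ∃ λ Y → Q —⟨ a , b ⟩→ Y × Closure X Y
  match-comm r v with sequentialise v
  match-comm r v | free t t' u u' refl with S-sim r t | S-sim r u
  ... | _ , t₁ , r₁ | _ , u₁ , r₂ with S-sim r₁ t' | S-sim r₂ u'
  ...   | _ , t₂ , r₃ | _ , u₂ , r₄ with in-out {ℓ = all-live} refl refl t₁ t₂ | out-in {ℓ = all-live} u₁ u₂
  ...     | inj₁ w | _      = _ , w , instances r₃
  ...     | inj₂ _ | inj₁ w = _ , w , instances r₄
  ...     | inj₂ h | inj₂ h' =
    ⊥-elim (<-irrefl (trans (sym (weight-inv r₃)) (weight-inv r₄)) (<-≤-trans h h'))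
  match-comm r v | bound {Y = Y} t t' u u' o with S-sim r t | S-sim r u
  ... | _ , t₁ , r₁ | _ , u₁ , r₂ with S-sim r₁ t' | S-sim r₂ u'
  ...   | _ , t₂ , r₃ | _ , u₂ , r₄ with in-bout {ℓ = all-live} refl refl t₁ t₂ | bout-in {ℓ = all-live} u₁ u₂
  ...     | inj₁ (extruding w o') | _ = _ , w , extruded o o' (instances r₃)
  ...     | inj₂ _ | inj₁ (extruding w o') =
    -- This order reaches `Y [ swap ]`; identifying the two swapped names removes the difference.
    _ , w , extruded (↥-resp o (sym (swap-inst Y))) o' (instances r₄)
  ...     | inj₂ h | inj₂ h' =
    ⊥-elim (<-irrefl (trans (sym (weight-inv r₃)) (trans (sym (weight-swap Y)) (weight-inv r₄))) (<-≤-trans h h'))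

  -- For `instances`, only created communications go beyond the simulation by `S`, and `match-comm`
  -- handles them. For `extruded`, the step is carried under the pulled restriction, simulated there
  -- and carried back.
  Closure-sim : Closure P Q → P —[ μ ]→ P' → ∃ λ Q' → Q —[ μ ]→ Q' × Closure P' Q'
  Closure-sim {μ = inL _} (instances {P} r) t with unsub-in P t
  ... | _ , _ , u , refl , refl with S-sim r u
  ...   | _ , v , r' = _ , sub-step v , instances r'
  Closure-sim {μ = outL _ _} (instances {P} r) t with unsub-out P t
  ... | _ , _ , _ , u , refl , refl , refl with S-sim r u
  ...   | _ , v , r' = _ , sub-step v , instances r'
  Closure-sim {μ = boutL _} (instances {P} r) t with unsub-bout P t
  ... | _ , _ , u , refl , refl with S-sim r u
  ...   | _ , v , r' = _ , sub-step v , instances r'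
  Closure-sim {μ = τ} (instances {P} r) t with unsub-τ P t
  ... | real u refl with S-sim r u
  ...   | _ , v , r' = _ , sub-step v , instances r'
  Closure-sim {μ = τ} (instances {P} {Q} {σ} r) t | created {a = a} u e refl with match-comm r u
  ...   | Y , v , r' =
    -- `σ` identifies the subjects, so the matching communication of `Q` becomes a reduction of the
    -- instance.
    _ , comm⇒τ (subst (λ n → (Q [ σ ]) —⟨ σ a , n ⟩→ (Y [ σ ])) (sym e) (sub-comm-step v)) , Closure-sub r'
  Closure-sim {μ = μ} (extruded o o' r) t with step-↥ o t
  ... | stays u o₁ with Closure-sim r u
  ...   | _ , v , r' with unstep μ o' v
  ...     | _ , w , o₂ = _ , w , extruded o₁ o₂ (Closure-swapIf (binding μ) r')
  Closure-sim (extruded o o' r) t | leaves u refl with Closure-sim r u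
  ...   | _ , v , r' = _ , unstep-leave o' v , r'

theorem5p8 : (P Q : Proc) (σ : ℕ → ℕ) → P ∼g Q → (P [ σ ]) ∼g (Q [ σ ])
theorem5p8 P Q σ (S , (S-sym , S-sim) , r) =
  Closure S-sym S-sim , (Closure-sym S-sym S-sim , Closure-sim S-sym S-sim) , instances r
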